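{- Let $k\ge1$ be an integer. Setting $s=p=kx$, $t=r=ky$, $u=(k-1)x+q$, and all other parameters ($a,b,c,d,f,g,h,\ell,w$) equal to $1$ in $\mathcal C$, one has $$\mathcal C(z)=\sum_{n\ge0}\sum_{\sigma\in\mathcal S_n^k}x^{\mathsf{exc}(\sigma)}y^{\mathsf{aexc}(\sigma)}q^{\mathsf{fix}(\sigma)}z^n .$$
   Context: A $k$-colored permutation of $[n]=\{1,\dots,n\}$ is a pair $(a_1a_2\ldots a_n,\ c_1c_2\ldots c_n)$ where $a_1a_2\ldots a_n$ is a permutation of $[n]$ (one-line notation) and each $c_i\in\{0,1,\dots,k-1\}$; the set of these is $\mathcal S_n^k$. For $P=(a_1\ldots a_n,c_1\ldots c_n)\in\mathcal S_n^k$: $\mathsf{exc}(P)$ is the number of $i\le n$ such that $a_i>i$, or $a_i=i$ and $c_i>0$; $\mathsf{aexc}(P)$ is the number of $i\le n$ with $a_i<i$; $\mathsf{fix}(P)$ is the number of $i\le n$ with $a_i=i$ and $c_i=0$. For $n\ge1$, $[n]_{x,y}:=\sum_{i=0}^{n-1}x^{n-1-i}y^{i}$, and $[0]_{x,y}:=0$. For parameters $a,b,c,d,f,g,h,\ell,p,r,s,t,u,w$, $\mathcal C(z)$ is the formal power series in $z$ defined by the continued fraction $$\mathcal C(z)=\cfrac{1}{1-\alpha_0z-\cfrac{\beta_1z^2}{1-\alpha_1z-\cfrac{\beta_2z^2}{\ddots}}},\qquad \alpha_n=u\,w^n+s\,[n]_{a,b}+t\,[n]_{f,g}\ (n\ge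 0),\quad \beta_n=p\,r\,[n]_{c,d}\,[n]_{h,\ell}\ (n\ge 1).$$ -}

module Defs where

open import Algebra.Bundles using (CommutativeRing)
open import Data.Fin.Base as Fin using (Fin; toℕ)
import Data.Fin.Properties as Fin
open import Data.List.Base as List using (List; cartesianProduct; cartesianProductWith)
open import Data.List.Membership.Propositional using (_∈_)
open import Data.List.Membership.Propositional.Properties
  using (∈-allFin; ∈-cartesianProductWith⁺; ∈-cartesianProduct⁺; ∈-filter⁺; ∈-filter⁻)
open import Data.List.Relation.Unary.Any using (here)
import Data.List.Relation.Unary.All as ListAll
import Data.List.Relation.Unary.AllPairs as ListAllPairs
import Data.List.Relation.Unary.Unique.Propositional as ListUnique
import Data.List.Relation.Unary.Unique.Propositional.Properties as ListUnique
open import Data.Nat.Base using (ℕ; zero; suc; _∸_; _<_; _≤_; z≤n; s≤s)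
import Data.Nat.Properties as ℕ
open import Data.Product.Base using (_×_; _,_; proj₁; proj₂)
open import Data.Sum.Base using (_⊎_)
open import Data.Vec.Base using (Vec; []; _∷_; lookup; head; count; allFin)
open import Data.Vec.Properties using (∷-injective)
open import Data.Vec.Relation.Unary.AllPairs using (allPairs?)
open import Data.Vec.Relation.Unary.Unique.Propositional using (Unique)
open import Relation.Binary.PropositionalEquality.Core as ≡ using (_≡_)
open import Relation.Nullary.Decidable using (Dec; ¬?; _⊎-dec_; _×-dec_)
open import Relation.Unary using (Decidable)

words : (n m : ℕ) → List (Vec (Fin n) m)
words n zero    = List.[ [] ]
words n (suc m) = cartesianProductWith _∷_ (List.allFin n) (words n m)

-- A word a₁…aₙ together with colors c₁…cₙ.  Letters and positions are
-- numbered from 0, which does not affect comparisons between them.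
ColoredWord : (k n : ℕ) → Set
ColoredWord k n = Vec (Fin n) n × Vec (Fin k) n

-- A word of length n over an alphabet of n letters is the one-line
-- notation of a permutation exactly when its letters are distinct.
IsColoredPermutation : ∀ {k n} → ColoredWord k n → Set
IsColoredPermutation (a , c) = Unique a

isColoredPermutation? : ∀ {k n} → Decidable (IsColoredPermutation {k} {n})
isColoredPermutation? (a , c) = allPairs? (λ i j → ¬? (i Fin.≟ j)) a

-- 𝒮ₙᵏ as a list; ∈-𝒮⁺, ∈-𝒮⁻ and 𝒮-unique below show that each colored
-- permutation occurs in it exactly once and nothing else does.
𝒮 : (k n : ℕ) → List (ColoredWord k n)
𝒮 k n = List.filter isColoredPermutation? (cartesianProduct (words n n) (words k n))

∈-words : ∀ {n m} (v : Vec (Fin n) m) → v ∈ words n m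
∈-words []      = here ≡.refl
∈-words (i ∷ v) = ∈-cartesianProductWith⁺ _∷_ (∈-allFin i) (∈-words v)

words-unique : ∀ n m → ListUnique.Unique (words n m)
words-unique n zero    = ListAll.[] ListAllPairs.∷ ListAllPairs.[]
words-unique n (suc m) =
  ListUnique.cartesianProductWith⁺ _∷_ ∷-injective (ListUnique.allFin⁺ n) (words-unique n m)

∈-𝒮⁺ : ∀ {k n} {P : ColoredWord k n} → IsColoredPermutation P → P ∈ 𝒮 k n
∈-𝒮⁺ {P = a , c} =
  ∈-filter⁺ isColoredPermutation? (∈-cartesianProduct⁺ (∈-words a) (∈-words c))

∈-𝒮⁻ : ∀ {k n} {P : ColoredWord k n} → P ∈ 𝒮 k n → IsColoredPermutation P
∈-𝒮⁻ {k} {n} P∈𝒮 =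
  proj₂ (∈-filter⁻ isColoredPermutation? {xs = cartesianProduct (words n n) (words k n)} P∈𝒮)

𝒮-unique : ∀ k n → ListUnique.Unique (𝒮 k n)
𝒮-unique k n = ListUnique.filter⁺ isColoredPermutation?
  (ListUnique.cartesianProduct⁺ (words-unique n n) (words-unique k n))

module _ {k n : ℕ} (P : ColoredWord k n) where

  private
    a : Fin n → Fin n
    a = lookup (proj₁ P)

    color : Fin n → ℕ
    color i = toℕ (lookup (proj₂ P) i)

  IsExc : Fin n → Set
  IsExc i = i Fin.< a i ⊎ (a i ≡ i × 0 < color i)

  IsAexc : Fin n → Set
  IsAexc i = a i Fin.< i

  IsFix : Fin n → Set
  IsFix i = a i ≡ i × color i ≡ 0

  isExc? : Decidable IsExc
  isExc? i = (i Fin.<? a i) ⊎-dec ((a i Fin.≟ i) ×-dec (0 ℕ.<? color i))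

  isAexc? : Decidable IsAexc
  isAexc? i = a i Fin.<? i

  isFix? : Decidable IsFix
  isFix? i = (a i Fin.≟ i) ×-dec (color i ℕ.≟ 0)

  exc aexc fix : ℕ
  exc  = count isExc? (allFin n)
  aexc = count isAexc? (allFin n)
  fix  = count isFix? (allFin n)

module PowerSeries {r₁ r₂} (R : CommutativeRing r₁ r₂) where

  open CommutativeRing R hiding (zero)
  open import Algebra.Properties.Semiring.Sum semiring using (sum⁺-syntax; sum-cong-≋)
  open import Relation.Binary.Reasoning.Setoid setoid

  -- A n is the coefficient of zⁿ.
  Series : Set r₁
  Series = ℕ → Carrier

  infix 4 _≋_
  _≋_ : Series → Series → Set r₂
  A ≋ B = ∀ n → A n ≈ B n

  𝟘 𝟙 : Series
  𝟘 _       = 0#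
  𝟙 zero    = 1#
  𝟙 (suc _) = 0#

  infixl 7 _⊛_
  _⊛_ : Series → Series → Series
  (A ⊛ B) n = ∑[ i ≤ n ] (A (toℕ i) * B (n ∸ toℕ i))

  -- The coefficients of degrees n, …, 1, 0 (in this order) of 1 / A, for
  -- a series A with constant coefficient 1 (see ⊛-inverse).
  inverseCoeffs : Series → ∀ n → Vec Carrier (suc n)
  inverseCoeffs A zero    = 1# ∷ []
  inverseCoeffs A (suc n) =
    - (∑[ i ≤ n ] (A (suc (toℕ i)) * lookup (inverseCoeffs A n) i)) ∷ inverseCoeffs A n

  inverse : Series → Series
  inverse A n = head (inverseCoeffs A n)

  lookup-inverseCoeffs : ∀ A n i → lookup (inverseCoeffs A n) i ≡ inverse A (n ∸ toℕ i)
  lookup-inverseCoeffs A zero    Fin.zero    = ≡.refl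
  lookup-inverseCoeffs A (suc n) Fin.zero    = ≡.refl
  lookup-inverseCoeffs A (suc n) (Fin.suc i) = lookup-inverseCoeffs A n i

  ⊛-inverse : ∀ A → A 0 ≈ 1# → A ⊛ inverse A ≋ 𝟙
  ⊛-inverse A A₀≈1 zero = begin
    A 0 * 1# + 0#  ≈⟨ +-identityʳ _ ⟩
    A 0 * 1#       ≈⟨ *-identityʳ _ ⟩
    A 0            ≈⟨ A₀≈1 ⟩
    1#             ∎
  ⊛-inverse A A₀≈1 (suc n) = begin
    A 0 * - S + ∑[ i ≤ n ] (A (suc (toℕ i)) * inverse A (n ∸ toℕ i))
      ≈⟨ +-congˡ (sum-cong-≋ λ i → *-congˡ {A (suc (toℕ i))} (reflexive (lookup-inverseCoeffs A n i))) ⟨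
    A 0 * - S + S
      ≈⟨ +-congʳ (trans (*-congʳ A₀≈1) (*-identityˡ _)) ⟩
    - S + S
      ≈⟨ -‿inverseˡ S ⟩
    0# ∎
    where
    S = ∑[ i ≤ n ] (A (suc (toℕ i)) * lookup (inverseCoeffs A n) i)

  inverseCoeffs-cong : ∀ {A B} n → (∀ {i} → i ≤ n → A i ≈ B i) →
                       ∀ j → lookup (inverseCoeffs A n) j ≈ lookup (inverseCoeffs B n) j
  inverseCoeffs-cong zero    A≈B Fin.zero    = refl
  inverseCoeffs-cong (suc n) A≈B (Fin.suc j) =
    inverseCoeffs-cong n (λ i≤n → A≈B (ℕ.m≤n⇒m≤1+n i≤n)) j
  inverseCoeffs-cong (suc n) A≈B Fin.zero    = -‿cong (sum-cong-≋ λ i →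
    *-cong (A≈B (Fin.toℕ<n i)) (inverseCoeffs-cong n (λ i≤n → A≈B (ℕ.m≤n⇒m≤1+n i≤n)) i))

  inverse-cong : ∀ {A B} n → (∀ {i} → i ≤ n → A i ≈ B i) → inverse A n ≈ inverse B n
  inverse-cong {A} {B} n A≈B = begin
    inverse A n                            ≡⟨ lookup-inverseCoeffs A n Fin.zero ⟨
    lookup (inverseCoeffs A n) Fin.zero    ≈⟨ inverseCoeffs-cong n A≈B Fin.zero ⟩
    lookup (inverseCoeffs B n) Fin.zero    ≡⟨ lookup-inverseCoeffs B n Fin.zero ⟩
    inverse B n                            ∎

  -- 1 - α z - β z² K
  denominator : (α β : Carrier) → Series → Series
  denominator α β K 0             = 1#
  denominator α β K 1             = - α
  denominator α β K (suc (suc n)) = - (β * K n)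

  module _ (α β : ℕ → Carrier) where

    -- The truncation to N levels of the part of the fraction starting
    -- with 1 / (1 - αₘz - ⋯).
    truncation : (N m : ℕ) → Series
    truncation zero    m = 𝟘
    truncation (suc N) m = inverse (denominator (α m) (β (suc m)) (truncation N (suc m)))

    convergent : ℕ → Series
    convergent N = truncation N 0

    -- 1 / (1 - α₀z - β₁z² / (1 - α₁z - β₂z² / ⋱)), as the limit of its
    -- convergents: the coefficient of zⁿ is the same in
    -- all convergents of more than n levels (see convergent-limit).
    continuedFraction : Series
    continuedFraction n = convergent (suc n) n

    truncation-stable : ∀ {N N′} m n → n < N → n < N′ →
                        truncation N m n ≈ truncation N′ m n
    truncation-stable {suc N} {suc N′} m n (s≤s n≤N) (s≤s n≤N′) =
      inverse-cong n λ {i} i≤n → go i (ℕ.≤-trans i≤n n≤N) (ℕ.≤-trans i≤n n≤N′)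
      where
      go : ∀ i → i ≤ N → i ≤ N′ →
           denominator (α m) (β (suc m)) (truncation N  (suc m)) i ≈
           denominator (α m) (β (suc m)) (truncation N′ (suc m)) i
      go 0             _   _    = refl
      go 1             _   _    = refl
      go (suc (suc i)) i<N i<N′ = -‿cong (*-congˡ
        (truncation-stable (suc m) i (ℕ.<⇒≤ i<N) (ℕ.<⇒≤ i<N′)))

    convergent-limit : ∀ n {N} → n < N → convergent N n ≈ continuedFraction n
    convergent-limit n n<N = truncation-stable 0 n n<N ℕ.≤-refl

module GeneratingFunctions {r₁ r₂} (R : CommutativeRing r₁ r₂) where

  open CommutativeRing R hiding (zero)
  open import Algebra.Properties.Semiring.Sum semiring using (sum-syntax)
  open import Algebra.Properties.Semiring.Exp semiring using (_^_)
  open import Algebra.Properties.Semiring.Mult semiring using () renaming (_×_ to _·_)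
  open PowerSeries R

  -- [ n ]⟨ x , y ⟩ = xⁿ⁻¹ + xⁿ⁻²y + ⋯ + yⁿ⁻¹
  [_]⟨_,_⟩ : ℕ → Carrier → Carrier → Carrier
  [ n ]⟨ x , y ⟩ = ∑[ i < n ] (x ^ (n ∸ 1 ∸ toℕ i) * y ^ toℕ i)

  record Parameters : Set r₁ where
    field
      a b c d f g h ℓ p r s t u w : Carrier

  module _ (params : Parameters) where

    open Parameters params

    α : ℕ → Carrier
    α n = u * w ^ n + s * [ n ]⟨ a , b ⟩ + t * [ n ]⟨ f , g ⟩

    -- Only the values at n ≥ 1 occur in 𝒞.
    β : ℕ → Carrier
    β n = p * r * [ n ]⟨ c , d ⟩ * [ n ]⟨ h , ℓ ⟩

    𝒞 : Series
    𝒞 = continuedFraction α β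

  weight : ∀ {k n} (x y q : Carrier) → ColoredWord k n → Carrier
  weight x y q σ = x ^ exc σ * y ^ aexc σ * q ^ fix σ

  coloredPermutationSeries : (k : ℕ) (x y q : Carrier) → Series
  coloredPermutationSeries k x y q n =
    List.foldr _+_ 0# (List.map (weight x y q) (𝒮 k n))

  specialization : (k : ℕ) (x y q : Carrier) → Parameters
  specialization k x y q = record
    { s = k · x
    ; p = k · x
    ; t = k · y
    ; r = k · y
    ; u = (k ∸ 1) · x + q
    ; a = 1# ; b = 1# ; c = 1# ; d = 1# ; f = 1# ; g = 1# ; h = 1# ; ℓ = 1# ; w = 1#
    }

{-# OPTIONS --safe #-}
-- Summing over the colors first turns the coefficient of zⁿ on the right into
-- the permanent of the n × n matrix with entries X = kx above, Y = ky below and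
-- Q = (k - 1)x + q on the diagonal.  More generally, let G(h, n) be the permanent
-- of this matrix bordered by h open rows (0 in the open columns, X elsewhere) and
-- h open columns (Y in the other rows).  Expanding along the first proper row
-- and column, with the entries beyond the border viewed as a new open row and
-- column, gives
--   G(h, n+1) = G(h+1, n) + (Q + hX + hY) G(h, n) + h²XY G(h-1, n),
-- which is the recurrence for weighted Motzkin paths from height h to 0 with the
-- coefficients of the continued fraction as weights.
module Submission where

open import Defs
open import Algebra.Bundles using (CommutativeRing)
open import Data.Bool.Base using (Bool; true; false; if_then_else_; _∧_; _∨_)
open import Data.Empty using (⊥-elim)
open import Data.Fin.Base as Fin using (Fin; toℕ; punchIn)
import Data.Fin.Properties as Fin
open import Data.List.Base as List
  using (List; []; _∷_; _++_; cartesianProductWith; replicate; tabulate)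
import Data.List.Properties as List
open import Data.List.Relation.Binary.Permutation.Propositional
  using (_↭_; prep; swap; ↭-refl; ↭-sym) renaming (refl to ↭refl; trans to ↭trans)
open import Data.List.Relation.Binary.Permutation.Propositional.Properties
  using (¬x∷xs↭[]) renaming (shift to ↭-shift)
open import Data.List.Relation.Unary.All as All using (All; []; _∷_)
import Data.List.Relation.Unary.All.Properties as All
open import Data.List.Relation.Unary.AllPairs using (AllPairs; []; _∷_)
import Data.List.Relation.Unary.AllPairs.Properties as AllPairs
open import Data.Maybe.Base using (Maybe; just; nothing)
open import Data.Nat.Base using (ℕ; zero; suc; pred; _∸_; _≤_)
import Data.Nat.Properties as ℕ
open import Data.Product.Base using (_,_)
open import Data.Vec.Base as Vec using (Vec; []; _∷_; lookup)
import Data.Vec.Properties as Vec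
import Data.Vec.Relation.Unary.All as VecAll
import Data.Vec.Relation.Unary.All.Properties as VecAll
open import Data.Vec.Relation.Unary.AllPairs as VecAllPairs using (allPairs?)
open import Data.Vec.Relation.Unary.Unique.Propositional using (Unique)
import Data.Vec.Relation.Unary.Unique.Propositional.Properties as Unique
open import Function.Base using (_∘_; id)
open import Function.Bundles using (mk⇔)
open import Relation.Binary.Definitions using (tri<; tri≈; tri>)
open import Relation.Binary.PropositionalEquality.Core as ≡ using (_≡_; _≢_)
open import Relation.Nullary.Decidable using (does; does-⇔; dec-true; dec-false; ¬?)
open import Relation.Nullary.Negation using (contradiction)
open import Relation.Unary using (Decidable)

-- Permanents as iterated sums over selections from lists

module Permanent {r₁ r₂} (R : CommutativeRing r₁ r₂) where

  open CommutativeRing R hiding (zero)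
  open import Algebra.Properties.Semiring.Mult semiring using () renaming (_×_ to _·_)
  open import Algebra.Solver.Ring.NaturalCoefficients.Default commutativeSemiring
    using (solve; _:=_; _:+_; _:*_; con)
  open import Relation.Binary.Reasoning.Setoid setoid

  module _ {ℓ} {L : Set ℓ} where

    -- Selection goes by position: equal labels give separate summands, and `f` also receives the
    -- list left after removal. This lets a submatrix be a pair of label lists.
    ∑select : (L → List L → Carrier) → List L → Carrier
    ∑select f []       = 0#
    ∑select f (x ∷ xs) = f x xs + ∑select (λ y ys → f y (x ∷ ys)) xs

    ∑select-congAll : ∀ {f g} {xs} → All (λ x → ∀ ys → f x ys ≈ g x ys) xs →
                      ∑select f xs ≈ ∑select g xs
    ∑select-congAll []           = refl
    ∑select-congAll {xs = x ∷ xs} (f≈g ∷ fs≈gs) =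
      +-cong (f≈g xs) (∑select-congAll (All.map (λ h ys → h (x ∷ ys)) fs≈gs))

    ∑select-cong : ∀ {f g} → (∀ x xs → f x xs ≈ g x xs) → ∀ xs → ∑select f xs ≈ ∑select g xs
    ∑select-cong f≈g xs = ∑select-congAll (All.universal f≈g xs)

    ∑select-+ : ∀ f g xs → ∑select (λ y ys → f y ys + g y ys) xs ≈ ∑select f xs + ∑select g xs
    ∑select-+ f g []       = sym (+-identityˡ 0#)
    ∑select-+ f g (x ∷ xs) = begin
      f x xs + g x xs + ∑select (λ y ys → f y (x ∷ ys) + g y (x ∷ ys)) xs
        ≈⟨ +-congˡ (∑select-+ _ _ xs) ⟩
      f x xs + g x xs + (F + G)
        ≈⟨ solve 4 (λ a b c d → (a :+ b) :+ (c :+ d) := (a :+ c) :+ (b :+ d)) refl _ _ _ _ ⟩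
      f x xs + F + (g x xs + G) ∎
      where
      F = ∑select (λ y ys → f y (x ∷ ys)) xs
      G = ∑select (λ y ys → g y (x ∷ ys)) xs

    ∑select-* : ∀ a f xs → a * ∑select f xs ≈ ∑select (λ y ys → a * f y ys) xs
    ∑select-* a f []       = zeroʳ a
    ∑select-* a f (x ∷ xs) = trans (distribˡ a _ _) (+-congˡ (∑select-* a _ xs))

    ∑select-0 : ∀ xs → ∑select (λ _ _ → 0#) xs ≈ 0#
    ∑select-0 []       = refl
    ∑select-0 (x ∷ xs) = trans (+-identityˡ _) (∑select-0 xs)

    ∑select-exchange : ∀ (f : L → List L → L → List L → Carrier) xs ys →
      ∑select (λ x xs′ → ∑select (f x xs′) ys) xs ≈
      ∑select (λ y ys′ → ∑select (λ x xs′ → f x xs′ y ys′) xs) ys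
    ∑select-exchange f []       ys = sym (∑select-0 ys)
    ∑select-exchange f (x ∷ xs) ys =
      trans (+-congˡ (∑select-exchange _ xs ys)) (sym (∑select-+ _ _ ys))

    -- Reordering permutes the summands but also the remaining lists handed to `f`, so `f` has to be
    -- invariant in its second argument.
    ∑select-↭ : ∀ {f} → (∀ x {xs ys} → xs ↭ ys → f x xs ≈ f x ys) →
                ∀ {xs ys} → xs ↭ ys → ∑select f xs ≈ ∑select f ys
    ∑select-↭ inv ↭refl         = refl
    ∑select-↭ inv (prep x xs↭ys) =
      +-cong (inv x xs↭ys) (∑select-↭ (λ y p → inv y (prep x p)) xs↭ys)
    ∑select-↭ {f} inv (swap {xs} {ys} x y xs↭ys) = begin
      f x (y ∷ xs) + (f y (x ∷ xs) + ∑select (λ z zs → f z (x ∷ y ∷ zs)) xs)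
        ≈⟨ +-cong (inv x (prep y xs↭ys)) (+-cong (inv y (prep x xs↭ys)) S≈S′) ⟩
      f x (y ∷ ys) + (f y (x ∷ ys) + S′)
        ≈⟨ solve 3 (λ a b c → a :+ (b :+ c) := b :+ (a :+ c)) refl _ _ _ ⟩
      f y (x ∷ ys) + (f x (y ∷ ys) + S′) ∎
      where
      S′ = ∑select (λ z zs → f z (y ∷ x ∷ zs)) ys
      S≈S′ : ∑select (λ z zs → f z (x ∷ y ∷ zs)) xs ≈ S′
      S≈S′ = trans (∑select-cong (λ z zs → inv z (swap x y ↭-refl)) xs)
                   (∑select-↭ (λ z p → inv z (prep y (prep x p))) xs↭ys)
    ∑select-↭ inv (↭trans p q) = trans (∑select-↭ inv p) (∑select-↭ inv q)

    -- Removing any of the `h` copies of `o` leaves the same list, so these selections are `h` equal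
    -- summands. The multiplicity is written as the ring element `h · 1#`, which the ring solver can
    -- treat as a variable.
    ∑select-replicate : ∀ f o h xs →
      ∑select f (replicate h o ++ xs) ≈
      h · 1# * f o (replicate (pred h) o ++ xs) + ∑select (λ y ys → f y (replicate h o ++ ys)) xs
    ∑select-replicate f o zero    xs = sym (trans (+-congʳ (zeroˡ _)) (+-identityˡ _))
    ∑select-replicate f o (suc h) xs = begin
      F + ∑select (λ y ys → f y (o ∷ ys)) (replicate h o ++ xs)
        ≈⟨ +-congˡ (∑select-replicate _ o h xs) ⟩
      F + (h · 1# * f o (o ∷ replicate (pred h) o ++ xs) + S)
        ≈⟨ +-congˡ (+-congʳ (pull h)) ⟩
      F + (h · 1# * F + S)
        ≈⟨ +-assoc _ _ _ ⟨
      F + h · 1# * F + S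
        ≈⟨ +-congʳ (trans (distribʳ _ _ _) (+-congʳ (*-identityˡ F))) ⟨
      suc h · 1# * F + S ∎
      where
      F = f o (replicate h o ++ xs)
      S = ∑select (λ y ys → f y (o ∷ replicate h o ++ ys)) xs
      -- `o ∷ replicate (pred h) o` is `replicate h o` only for positive `h`; at 0 the factor
      -- `h · 1#` makes both sides vanish.
      pull : ∀ h → h · 1# * f o (o ∷ replicate (pred h) o ++ xs) ≈ h · 1# * f o (replicate h o ++ xs)
      pull zero    = trans (zeroˡ _) (sym (zeroˡ _))
      pull (suc h) = refl

  module _ {ℓ} {L : Set ℓ} (w : L → L → Carrier) where

    -- The permanent of the matrix with entries `w r c`, expanded along its first row; it is 0 if
    -- the two lists have different lengths.
    per : List L → List L → Carrier
    per []       []      = 1#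
    per []       (_ ∷ _) = 0#
    per (r ∷ rs) cs      = ∑select (λ c cs′ → w r c * per rs cs′) cs

    -- The term of the first row that picks `c` occurs on both sides. In the others, the smaller
    -- permanents are expanded along `c` by induction, and the two independent selections are
    -- exchanged.
    per-columnExpansion : ∀ rs c cs → per rs (c ∷ cs) ≈ ∑select (λ r rs′ → w r c * per rs′ cs) rs
    per-columnExpansion []       c cs = refl
    per-columnExpansion (r ∷ rs) c cs = +-congˡ (begin
      ∑select (λ d cs′ → w r d * per rs (c ∷ cs′)) cs
        ≈⟨ ∑select-cong (λ d cs′ → trans (*-congˡ (per-columnExpansion rs c cs′)) (∑select-* _ _ rs)) cs ⟩
      ∑select (λ d cs′ → ∑select (λ s rs′ → w r d * (w s c * per rs′ cs′)) rs) cs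
        ≈⟨ ∑select-exchange _ cs rs ⟩
      ∑select (λ s rs′ → ∑select (λ d cs′ → w r d * (w s c * per rs′ cs′)) cs) rs
        ≈⟨ ∑select-cong (λ s rs′ → trans (∑select-cong (λ d cs′ → x*yz≈y*xz _ _ _) cs) (sym (∑select-* _ _ cs))) rs ⟩
      ∑select (λ s rs′ → w s c * ∑select (λ d cs′ → w r d * per rs′ cs′) cs) rs ∎)
      where
      x*yz≈y*xz : ∀ x y z → x * (y * z) ≈ y * (x * z)
      x*yz≈y*xz = solve 3 (λ x y z → x :* (y :* z) := y :* (x :* z)) refl

    per-↭ʳ : ∀ rs {cs ds} → cs ↭ ds → per rs cs ≈ per rs ds
    per-↭ʳ []       {[]}    {[]}    p = refl
    per-↭ʳ []       {[]}    {_ ∷ _} p = ⊥-elim (¬x∷xs↭[] (↭-sym p))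
    per-↭ʳ []       {_ ∷ _} {[]}    p = ⊥-elim (¬x∷xs↭[] p)
    per-↭ʳ []       {_ ∷ _} {_ ∷ _} p = refl
    per-↭ʳ (r ∷ rs)                 p = ∑select-↭ (λ x q → *-congˡ (per-↭ʳ rs q)) p

    -- Induction on the columns instead of the rows: `per-columnExpansion` gives the rows the role
    -- that the columns have in `per-↭ʳ`.
    per-↭ˡ : ∀ cs {rs ss} → rs ↭ ss → per rs cs ≈ per ss cs
    per-↭ˡ []       {[]}    {[]}    p = refl
    per-↭ˡ []       {[]}    {_ ∷ _} p = ⊥-elim (¬x∷xs↭[] (↭-sym p))
    per-↭ˡ []       {_ ∷ _} {[]}    p = ⊥-elim (¬x∷xs↭[] p)
    per-↭ˡ []       {_ ∷ _} {_ ∷ _} p = refl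
    per-↭ˡ (c ∷ cs) {rs}    {ss}    p = begin
      per rs (c ∷ cs)                          ≈⟨ per-columnExpansion rs c cs ⟩
      ∑select (λ r rs′ → w r c * per rs′ cs) rs  ≈⟨ ∑select-↭ (λ x q → *-congˡ (per-↭ˡ cs q)) p ⟩
      ∑select (λ r rs′ → w r c * per rs′ cs) ss  ≈⟨ per-columnExpansion ss c cs ⟨
      per ss (c ∷ cs)                          ∎

    -- Permanents bordered by open rows and columns

    module _ (o : L) (w-oo : w o o ≈ 0#) where

      infixr 5 _⊕_
      _⊕_ : ℕ → List L → List L
      h ⊕ xs = replicate h o ++ xs

      private
        drop-oo : ∀ a b z → a * (w o o * b) + z ≈ z
        drop-oo a b z = begin
          a * (w o o * b) + z  ≈⟨ +-congʳ (*-congˡ (*-congʳ w-oo)) ⟩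
          a * (0# * b) + z     ≈⟨ solve 3 (λ a b z → a :* (con 0 :* b) :+ z := z) refl a b z ⟩
          z                    ∎

      -- The `h` open columns contribute only multiples of `w o o`, so an open row has to be matched
      -- inside `T`.
      per-openRow : ∀ rs h T → per (o ∷ rs) (h ⊕ T) ≈ ∑select (λ c cs → w o c * per rs (h ⊕ cs)) T
      per-openRow rs h T = trans (∑select-replicate _ o h T) (drop-oo _ _ _)

      per-openColumn : ∀ cs h T → per (h ⊕ T) (o ∷ cs) ≈ ∑select (λ r rs → w r o * per (h ⊕ rs) cs) T
      per-openColumn cs h T = trans (per-columnExpansion (h ⊕ T) o cs)
        (trans (∑select-replicate _ o h T) (drop-oo _ _ _))

      -- The columns of `i` and `o` differ only in the `h` open rows, where `w o i` stands in place
      -- of `w o o`; the first summand collects exactly these entries.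
      per-newColumn : ∀ i cs h T → All (λ r → w r i ≈ w r o) T →
        per (h ⊕ T) (i ∷ cs) ≈
        h · 1# * (w o i * per (pred h ⊕ T) cs) + per (h ⊕ T) (o ∷ cs)
      per-newColumn i cs h T wi≈wo = begin
        per (h ⊕ T) (i ∷ cs)
          ≈⟨ per-columnExpansion (h ⊕ T) i cs ⟩
        ∑select (λ r rs → w r i * per rs cs) (h ⊕ T)
          ≈⟨ ∑select-replicate _ o h T ⟩
        h · 1# * (w o i * per (pred h ⊕ T) cs) + ∑select (λ r rs → w r i * per (h ⊕ rs) cs) T
          ≈⟨ +-congˡ (∑select-congAll (All.map (λ eq rs → *-congʳ eq) wi≈wo)) ⟩
        h · 1# * (w o i * per (pred h ⊕ T) cs) + ∑select (λ r rs → w r o * per (h ⊕ rs) cs) T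
          ≈⟨ +-congˡ (per-openColumn cs h T) ⟨
        h · 1# * (w o i * per (pred h ⊕ T) cs) + per (h ⊕ T) (o ∷ cs) ∎

      openPer : ℕ → List L → Carrier
      openPer h T = per (h ⊕ T) (h ⊕ T)

      -- Against the labels of T, i behaves like o, so an expansion along the row
      -- or column of i minus its entries at o is an expansion along that of o.
      openPer-recurrence : ∀ h i T → All (λ r → w r i ≈ w r o) T → All (λ c → w i c ≈ w o c) T →
        openPer h (i ∷ T) ≈
        openPer (suc h) T
        + (w i i + h · 1# * w o i + h · 1# * w i o) * openPer h T
        + h · 1# * (h · 1# * (w o i * w i o)) * openPer (pred h) T
      openPer-recurrence h i T wi≈wo iw≈ow = begin
        per (h ⊕ i ∷ T) (h ⊕ i ∷ T)
          ≈⟨ per-↭ˡ (h ⊕ i ∷ T) moveToFront ⟩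
        per (i ∷ h ⊕ T) (h ⊕ i ∷ T)
          ≈⟨ per-↭ʳ (i ∷ h ⊕ T) moveToFront ⟩
        w i i * G + ∑select (λ c cs → w i c * per (h ⊕ T) (i ∷ cs)) (h ⊕ T)
          ≈⟨ +-congˡ (∑select-replicate _ o h T) ⟩
        w i i * G + (N * (w i o * per (h ⊕ T) (i ∷ pred h ⊕ T))
                     + ∑select (λ c cs → w i c * per (h ⊕ T) (i ∷ h ⊕ cs)) T)
          ≈⟨ +-congˡ (+-cong openPart newPart) ⟩
        w i i * G + (N * (w i o * (N * (w o i * G⁻) + G)) + (N * w o i * G + G⁺))
          ≈⟨ solve 7 (λ ii oi io N G G⁻ G⁺ →
               ii :* G :+ (N :* (io :* (N :* (oi :* G⁻) :+ G)) :+ (N :* oi :* G :+ G⁺)) :=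
               G⁺ :+ (ii :+ N :* oi :+ N :* io) :* G :+ N :* (N :* (oi :* io)) :* G⁻)
               refl (w i i) (w o i) (w i o) N G G⁻ G⁺ ⟩
        G⁺ + (w i i + N * w o i + N * w i o) * G + N * (N * (w o i * w i o)) * G⁻ ∎
        where
        N  = h · 1#
        G  = openPer h T
        G⁻ = openPer (pred h) T
        G⁺ = openPer (suc h) T

        moveToFront : (h ⊕ i ∷ T) ↭ (i ∷ h ⊕ T)
        moveToFront = ↭-shift i (replicate h o) T

        -- For positive `h`, `o ∷ pred h ⊕ T` is `h ⊕ T`. At 0 it is one column too long, but the
        -- factor `h · 1#` is zero.
        reopen : ∀ h → h · 1# * (w i o * (h · 1# * (w o i * openPer (pred h) T) + per (h ⊕ T) (o ∷ pred h ⊕ T)))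
                     ≈ h · 1# * (w i o * (h · 1# * (w o i * openPer (pred h) T) + openPer h T))
        reopen zero    = trans (zeroˡ _) (sym (zeroˡ _))
        reopen (suc h) = refl

        -- Row `i` uses an open column. Column `i` then either uses an open row, which lowers the
        -- height, or replaces the open column just used, which keeps it.
        openPart : N * (w i o * per (h ⊕ T) (i ∷ pred h ⊕ T)) ≈ N * (w i o * (N * (w o i * G⁻) + G))
        openPart = trans (*-congˡ (*-congˡ (per-newColumn i (pred h ⊕ T) h T wi≈wo))) (reopen h)

        -- Column `i` has used an open row, and row `i`, acting on `T` like an open row, takes its
        -- place. The height stays the same.
        closeRow : ∀ h → h · 1# * w o i * ∑select (λ c cs → w o c * per (pred h ⊕ T) (h ⊕ cs)) T
                       ≈ h · 1# * w o i * openPer h T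
        closeRow zero    = trans (*-congʳ (zeroˡ _)) (trans (zeroˡ _)
                             (sym (trans (*-congʳ (zeroˡ _)) (zeroˡ _))))
        closeRow (suc h) = *-congˡ (sym (per-openRow (h ⊕ T) (suc h) T))

        -- Row `i` is matched inside `T`. If column `i` is also matched there, both count as newly
        -- opened and the height rises to `suc h`; otherwise `closeRow` applies.
        newPart : ∑select (λ c cs → w i c * per (h ⊕ T) (i ∷ h ⊕ cs)) T ≈ N * w o i * G + G⁺
        newPart = begin
          ∑select (λ c cs → w i c * per (h ⊕ T) (i ∷ h ⊕ cs)) T
            ≈⟨ ∑select-congAll (All.map (λ eq cs → *-cong eq (per-newColumn i (h ⊕ cs) h T wi≈wo)) iw≈ow) ⟩
          ∑select (λ c cs → w o c * (N * (w o i * per (pred h ⊕ T) (h ⊕ cs)) + per (h ⊕ T) (suc h ⊕ cs))) T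
            ≈⟨ ∑select-cong (λ c cs → solve 5 (λ a n b p q →
                 a :* (n :* (b :* p) :+ q) := n :* b :* (a :* p) :+ a :* q) refl _ _ _ _ _) T ⟩
          ∑select (λ c cs → N * w o i * (w o c * per (pred h ⊕ T) (h ⊕ cs)) + w o c * per (h ⊕ T) (suc h ⊕ cs)) T
            ≈⟨ ∑select-+ _ _ T ⟩
          ∑select (λ c cs → N * w o i * (w o c * per (pred h ⊕ T) (h ⊕ cs))) T
          + ∑select (λ c cs → w o c * per (h ⊕ T) (suc h ⊕ cs)) T
            ≈⟨ +-cong (∑select-* _ _ T) (per-openRow (h ⊕ T) (suc h) T) ⟨
          N * w o i * ∑select (λ c cs → w o c * per (pred h ⊕ T) (h ⊕ cs)) T + G⁺
            ≈⟨ +-congʳ (closeRow h) ⟩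
          N * w o i * G + G⁺ ∎

-- Continued fractions and weighted Motzkin paths

module ContinuedFraction {r₁ r₂} (R : CommutativeRing r₁ r₂) where

  open CommutativeRing R hiding (zero)
  open PowerSeries R
  open import Algebra.Properties.Ring ring using (-‿distribˡ-*; -‿+-comm; -‿involutive; -0#≈0#)
  open import Algebra.Properties.Semiring.Sum semiring
    using (sum-cong-≋; *-distribˡ-sum; ∑-distrib-+)
  open import Algebra.Solver.Ring.NaturalCoefficients.Default commutativeSemiring
    using (solve; _:=_; _:+_; _:*_; con)
  open import Relation.Binary.Reasoning.Setoid setoid

  shift : Series → Series
  shift A zero    = 0#
  shift A (suc n) = A n

  shift-cong : ∀ {A B} → A ≋ B → shift A ≋ shift B
  shift-cong A≋B zero    = refl
  shift-cong A≋B (suc n) = A≋B n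

  ⊛-congˡ : ∀ {A B C} → B ≋ C → A ⊛ B ≋ A ⊛ C
  ⊛-congˡ {A} B≋C n = sum-cong-≋ {suc n} λ i → *-congˡ {A (toℕ i)} (B≋C (n ∸ toℕ i))

  ⊛-congʳ : ∀ {A B C} → A ≋ B → A ⊛ C ≋ B ⊛ C
  ⊛-congʳ {C = C} A≋B n = sum-cong-≋ {suc n} λ i → *-congʳ {C (n ∸ toℕ i)} (A≋B (toℕ i))

  ⊛-distribʳ-+ : ∀ A B C → (λ i → A i + B i) ⊛ C ≋ (λ n → (A ⊛ C) n + (B ⊛ C) n)
  ⊛-distribʳ-+ A B C n = trans
    (sum-cong-≋ {suc n} λ i → distribʳ (C (n ∸ toℕ i)) (A (toℕ i)) (B (toℕ i)))
    (∑-distrib-+ {suc n} (λ i → A (toℕ i) * C (n ∸ toℕ i)) (λ i → B (toℕ i) * C (n ∸ toℕ i)))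

  ⊛-scaleˡ : ∀ a A B → (λ i → a * A i) ⊛ B ≋ (λ n → a * (A ⊛ B) n)
  ⊛-scaleˡ a A B n = trans
    (sum-cong-≋ {suc n} λ i → *-assoc a (A (toℕ i)) (B (n ∸ toℕ i)))
    (sym (*-distribˡ-sum {suc n} a (λ i → A (toℕ i) * B (n ∸ toℕ i))))

  ⊛-scaleʳ : ∀ a A B → A ⊛ (λ i → a * B i) ≋ (λ n → a * (A ⊛ B) n)
  ⊛-scaleʳ a A B n = trans
    (sum-cong-≋ {suc n} λ i →
      solve 3 (λ a x y → x :* (a :* y) := a :* (x :* y)) refl a (A (toℕ i)) (B (n ∸ toℕ i)))
    (sym (*-distribˡ-sum {suc n} a (λ i → A (toℕ i) * B (n ∸ toℕ i))))

  -- Induction on the degree: splitting off the constant coefficient of `A` leaves a product with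
  -- `A ∘ suc` in one degree less.
  ⊛-assoc : ∀ A B C → (A ⊛ B) ⊛ C ≋ A ⊛ (B ⊛ C)
  ⊛-assoc A B C zero = solve 3 (λ a b c →
    (a :* b :+ con 0) :* c :+ con 0 := a :* (b :* c :+ con 0) :+ con 0) refl _ _ _
  ⊛-assoc A B C (suc n) = begin
    (A 0 * B 0 + 0#) * C (suc n) + ((λ i → A 0 * B (suc i) + (A ∘ suc ⊛ B) i) ⊛ C) n
      ≈⟨ +-congˡ (trans (⊛-distribʳ-+ (λ i → A 0 * B (suc i)) (A ∘ suc ⊛ B) C n)
           (+-cong (⊛-scaleˡ (A 0) (B ∘ suc) C n) (⊛-assoc (A ∘ suc) B C n))) ⟩
    (A 0 * B 0 + 0#) * C (suc n) + (A 0 * (B ∘ suc ⊛ C) n + (A ∘ suc ⊛ (B ⊛ C)) n)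
      ≈⟨ solve 5 (λ a b c d e →
           (a :* b :+ con 0) :* c :+ (a :* d :+ e) := a :* (b :* c :+ d) :+ e) refl _ _ _ _ _ ⟩
    A 0 * (B 0 * C (suc n) + (B ∘ suc ⊛ C) n) + (A ∘ suc ⊛ (B ⊛ C)) n ∎

  shift-⊛ : ∀ A B → shift A ⊛ B ≋ shift (A ⊛ B)
  shift-⊛ A B zero    = solve 1 (λ b → con 0 :* b :+ con 0 := con 0) refl _
  shift-⊛ A B (suc n) = trans (+-congʳ (zeroˡ _)) (+-identityˡ _)

  ⊛-shift : ∀ A B → A ⊛ shift B ≋ shift (A ⊛ B)
  ⊛-shift A B zero          = solve 1 (λ a → a :* con 0 :+ con 0 := con 0) refl _
  ⊛-shift A B (suc zero)    = +-congˡ (⊛-shift (A ∘ suc) B zero)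
  ⊛-shift A B (suc (suc n)) = +-congˡ (⊛-shift (A ∘ suc) B (suc n))

  inverse-suc : ∀ A n → inverse A (suc n) ≈ - (A ∘ suc ⊛ inverse A) n
  inverse-suc A n = -‿cong (sum-cong-≋ λ i → *-congˡ {A (suc (toℕ i))} (reflexive (lookup-inverseCoeffs A n i)))

  -- This is J = 1 + αzJ + βz²KJ read in degree n + 1; `shift` supplies the second factor z, so the
  -- last term vanishes at n = 0.
  inverse-denominator : ∀ α β K n → let J = inverse (denominator α β K) in
    J (suc n) ≈ α * J n + β * shift (K ⊛ J) n
  inverse-denominator α β K n = begin
    J (suc n)                              ≈⟨ inverse-suc (denominator α β K) n ⟩
    - (denominator α β K ∘ suc ⊛ J) n      ≈⟨ -‿cong (step n) ⟩
    - (- (α * J n) + - (β * shift (K ⊛ J) n)) ≈⟨ -‿cong (-‿+-comm _ _) ⟩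
    - - (α * J n + β * shift (K ⊛ J) n)    ≈⟨ -‿involutive _ ⟩
    α * J n + β * shift (K ⊛ J) n          ∎
    where
    J = inverse (denominator α β K)
    step : ∀ n → (denominator α β K ∘ suc ⊛ J) n ≈ - (α * J n) + - (β * shift (K ⊛ J) n)
    step zero    = +-cong (sym (-‿distribˡ-* _ _)) (sym (trans (-‿cong (zeroʳ β)) -0#≈0#))
    step (suc n) = +-cong (sym (-‿distribˡ-* _ _)) (begin
      ((λ i → - (β * K i)) ⊛ J) n  ≈⟨ ⊛-congʳ {B = λ i → - β * K i} {C = J} (λ i → -‿distribˡ-* β (K i)) n ⟩
      ((λ i → - β * K i) ⊛ J) n    ≈⟨ ⊛-scaleˡ (- β) K J n ⟩
      - β * (K ⊛ J) n              ≈⟨ -‿distribˡ-* _ _ ⟨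
      - (β * (K ⊛ J) n)            ∎)

  module _ (α β : ℕ → Carrier) where

    -- The limit of the truncations that start at level `m`: n + 1 levels already determine the
    -- coefficient of zⁿ. At `m` = 0 this is `continuedFraction α β` by definition.
    tailFraction : ℕ → Series
    tailFraction m n = truncation α β (suc n) m n

    -- The number of levels on the left varies with `n`. The coefficient of zⁿ reads the denominator
    -- only up to degree n, hence the next tail only up to degree n - 2, where `n` levels suffice by
    -- `truncation-stable`.
    tailFraction-inverse : ∀ m →
      tailFraction m ≋ inverse (denominator (α m) (β (suc m)) (tailFraction (suc m)))
    tailFraction-inverse m n = inverse-cong n (go n)
      where
      go : ∀ n {i} → i ≤ n →
           denominator (α m) (β (suc m)) (truncation α β n (suc m)) i ≈
           denominator (α m) (β (suc m)) (tailFraction (suc m)) i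
      go n {zero}        _   = refl
      go n {suc zero}    _   = refl
      go n {suc (suc i)} i<n = -‿cong (*-congˡ
        (truncation-stable α β (suc m) i (ℕ.<⇒≤ i<n) ℕ.≤-refl))

    tailFraction-suc : ∀ m n → tailFraction m (suc n) ≈
      α m * tailFraction m n + β (suc m) * shift (tailFraction (suc m) ⊛ tailFraction m) n
    tailFraction-suc m n = begin
      K m (suc n)
        ≈⟨ K≋J (suc n) ⟩
      J (suc n)
        ≈⟨ inverse-denominator (α m) (β (suc m)) (K (suc m)) n ⟩
      α m * J n + β (suc m) * shift (K (suc m) ⊛ J) n
        ≈⟨ +-cong (*-congˡ (K≋J n)) (*-congˡ (shift-cong {K (suc m) ⊛ K m} (⊛-congˡ {K (suc m)} K≋J) n)) ⟨
      α m * K m n + β (suc m) * shift (K (suc m) ⊛ K m) n ∎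
      where
      K = tailFraction
      J = inverse (denominator (α m) (β (suc m)) (K (suc m)))
      K≋J : K m ≋ J
      K≋J = tailFraction-inverse m

    -- Motzkin paths from height h to 0, cut at their first visits to the
    -- heights h - 1, …, 0: the part above height h is counted by tailFraction h.
    descent : ℕ → Series
    descent zero    = tailFraction 0
    descent (suc h) = λ n → β (suc h) * shift (tailFraction (suc h) ⊛ descent h) n

    -- Weighted Motzkin paths with `n` steps from height `h` to 0, sorted by their first step: up
    -- with weight 1, level with `α h`, down with `β h`. As `pred 0` is 0, a spurious third term
    -- arises at height 0, which the assumption `β 0 ≈ 0#` below removes.
    motzkin : ℕ → ℕ → Carrier
    motzkin zero    zero    = 1#
    motzkin (suc h) zero    = 0#
    motzkin h       (suc n) = motzkin (suc h) n + α h * motzkin h n + β h * motzkin (pred h) n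

    motzkin-suc : ∀ h n →
      motzkin h (suc n) ≡ motzkin (suc h) n + α h * motzkin h n + β h * motzkin (pred h) n
    motzkin-suc zero    n = ≡.refl
    motzkin-suc (suc h) n = ≡.refl

    module _ (β₀≈0 : β 0 ≈ 0#) where

      -- Algebraic form of sorting paths by their first step: `tailFraction-suc` unrolls the first
      -- factor of the descent by one level.
      descent-suc : ∀ h n →
        descent h (suc n) ≈ descent (suc h) n + α h * descent h n + β h * descent (pred h) n
      descent-suc zero n = begin
        K 0 (suc n)
          ≈⟨ tailFraction-suc 0 n ⟩
        α 0 * K 0 n + descent 1 n
          ≈⟨ +-comm _ _ ⟩
        descent 1 n + α 0 * K 0 n
          ≈⟨ +-identityʳ _ ⟨
        descent 1 n + α 0 * K 0 n + 0#
          ≈⟨ +-congˡ (trans (*-congʳ β₀≈0) (zeroˡ _)) ⟨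
        descent 1 n + α 0 * K 0 n + β 0 * K 0 n ∎
        where K = tailFraction
      -- The `1#` is the constant coefficient of `tailFraction (suc h)`.
      descent-suc (suc h) zero = begin
        b * (1# * D 0 + 0#)
          ≈⟨ solve 5 (λ a b b′ d u → b :* (u :* d :+ con 0) :=
               b′ :* con 0 :+ a :* (b :* con 0) :+ b :* (u :* d)) refl a b b′ (D 0) 1# ⟩
        b′ * 0# + a * (b * 0#) + b * (1# * D 0)
          ≈⟨ +-congˡ (*-congˡ (*-identityˡ _)) ⟩
        b′ * 0# + a * (b * 0#) + b * D 0 ∎
        where
        a = α (suc h)
        b = β (suc h)
        b′ = β (suc (suc h))
        D = descent h
      -- The constant coefficient 1 of `K` gives the step down. The rest of `K`, rewritten in
      -- `tail`, gives the level step and the step up.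
      descent-suc (suc h) (suc n) = begin
        b * (1# * D (suc n) + (K ∘ suc ⊛ D) n)
          ≈⟨ *-congˡ (+-cong (*-identityˡ _) tail) ⟩
        b * (D (suc n) + (a * (K ⊛ D) n + b′ * shift (K′ ⊛ (K ⊛ D)) n))
          ≈⟨ solve 6 (λ b b′ a d e f → b :* (d :+ (a :* e :+ b′ :* f)) :=
               b′ :* (b :* f) :+ a :* (b :* e) :+ b :* d) refl _ _ _ _ _ _ ⟩
        b′ * (b * shift (K′ ⊛ (K ⊛ D)) n) + a * (b * (K ⊛ D) n) + b * D (suc n)
          ≈⟨ +-congʳ (+-congʳ (*-congˡ (trans (⊛-scaleʳ b K′ (shift (K ⊛ D)) n)
               (*-congˡ (⊛-shift K′ (K ⊛ D) n))))) ⟨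
        b′ * (K′ ⊛ descent (suc h)) n + a * (b * (K ⊛ D) n) + b * D (suc n) ∎
        where
        a = α (suc h)
        b = β (suc h)
        b′ = β (suc (suc h))
        D = descent h
        K = tailFraction (suc h)
        K′ = tailFraction (suc (suc h))
        tail : (K ∘ suc ⊛ D) n ≈ a * (K ⊛ D) n + b′ * shift (K′ ⊛ (K ⊛ D)) n
        tail = begin
          (K ∘ suc ⊛ D) n
            ≈⟨ ⊛-congʳ {C = D} (tailFraction-suc (suc h)) n ⟩
          ((λ i → a * K i + b′ * shift (K′ ⊛ K) i) ⊛ D) n
            ≈⟨ ⊛-distribʳ-+ (λ i → a * K i) (λ i → b′ * shift (K′ ⊛ K) i) D n ⟩
          ((λ i → a * K i) ⊛ D) n + ((λ i → b′ * shift (K′ ⊛ K) i) ⊛ D) n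
            ≈⟨ +-cong (⊛-scaleˡ a K D n) (⊛-scaleˡ b′ (shift (K′ ⊛ K)) D n) ⟩
          a * (K ⊛ D) n + b′ * (shift (K′ ⊛ K) ⊛ D) n
            ≈⟨ +-congˡ (*-congˡ (trans (shift-⊛ (K′ ⊛ K) D n) (shift-cong {(K′ ⊛ K) ⊛ D} (⊛-assoc K′ K D) n))) ⟩
          a * (K ⊛ D) n + b′ * shift (K′ ⊛ (K ⊛ D)) n ∎

      descent≋motzkin : ∀ n h → descent h n ≈ motzkin h n
      descent≋motzkin zero    zero    = refl
      descent≋motzkin zero    (suc h) = zeroʳ _
      descent≋motzkin (suc n) h = trans (descent-suc h n) (trans
        (+-cong (+-cong (descent≋motzkin n (suc h)) (*-congˡ (descent≋motzkin n h)))
                (*-congˡ (descent≋motzkin n (pred h))))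
        (reflexive (≡.sym (motzkin-suc h n))))

      continuedFraction≋motzkin : continuedFraction α β ≋ motzkin 0
      continuedFraction≋motzkin n = descent≋motzkin n 0

-- Sums over words, and permanents as sums over permutations

unique? : ∀ {n m} → Decidable (Unique {A = Fin n} {m})
unique? = allPairs? (λ i j → ¬? (i Fin.≟ j))

-- The same check that `unique?` runs on the first letter: on `j ∷ v`, `unique?` computes to a
-- conjunction that `guard-∧` can split.
distinctFrom? : ∀ {n m} (j : Fin n) → Decidable (VecAll.All (j ≢_) {m})
distinctFrom? j = VecAll.all? (λ i → ¬? (j Fin.≟ i))

unique-map⁻ : ∀ {a b} {A : Set a} {B : Set b} {f : A → B} {n} {v : Vec A n} →
              Unique (Vec.map f v) → Unique v
unique-map⁻ {v = []}    VecAllPairs.[]          = VecAllPairs.[]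
unique-map⁻ {f = f} {v = _ ∷ _} (x∉v VecAllPairs.∷ v!) =
  VecAll.map (λ fx≢fy x≡y → fx≢fy (≡.cong f x≡y)) (VecAll.map⁻ x∉v) VecAllPairs.∷ unique-map⁻ v!

unique?-punchIn : ∀ {n m} j (v : Vec (Fin n) m) →
                  does (unique? (Vec.map (punchIn j) v)) ≡ does (unique? v)
unique?-punchIn j v = does-⇔
  (mk⇔ unique-map⁻ (Unique.map⁺ (Fin.punchIn-injective j _ _)))
  (unique? (Vec.map (punchIn j) v)) (unique? v)

module WordSums {r₁ r₂} (R : CommutativeRing r₁ r₂) where

  open CommutativeRing R hiding (zero)
  open import Algebra.Properties.Semiring.Sum semiring
    using (sum; sum-syntax; sum-cong-≋; sum-remove; *-distribʳ-sum)
  open import Algebra.Properties.CommutativeMonoid.Sum *-commutativeMonoid using ()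
    renaming (sum to product; sum-cong-≋ to product-cong)
  open import Algebra.Properties.Semiring.Exp semiring using (_^_)
  open import Relation.Binary.Reasoning.Setoid setoid
  open Permanent R

  ∑ᴸ : ∀ {a} {A : Set a} → (A → Carrier) → List A → Carrier
  ∑ᴸ f xs = List.foldr _+_ 0# (List.map f xs)

  -- A condition inside the summand leaves the full list `words` as the range, which can still be
  -- split letter by letter.
  guard : Bool → Carrier → Carrier
  guard b z = if b then z else 0#

  guard-cong : ∀ b {y z} → y ≈ z → guard b y ≈ guard b z
  guard-cong true  y≈z = y≈z
  guard-cong false y≈z = refl

  guard-* : ∀ b y z → guard b (y * z) ≈ y * guard b z
  guard-* true  y z = refl
  guard-* false y z = sym (zeroʳ y)

  guard-∧ : ∀ b c z → guard (b ∧ c) z ≡ guard b (guard c z)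
  guard-∧ true  c z = ≡.refl
  guard-∧ false c z = ≡.refl

  module _ {a} {A : Set a} where

    ∑ᴸ-cong : ∀ {f g : A → Carrier} → (∀ x → f x ≈ g x) → ∀ xs → ∑ᴸ f xs ≈ ∑ᴸ g xs
    ∑ᴸ-cong f≈g []       = refl
    ∑ᴸ-cong f≈g (x ∷ xs) = +-cong (f≈g x) (∑ᴸ-cong f≈g xs)

    ∑ᴸ-* : ∀ y (f : A → Carrier) xs → y * ∑ᴸ f xs ≈ ∑ᴸ (λ x → y * f x) xs
    ∑ᴸ-* y f []       = zeroʳ y
    ∑ᴸ-* y f (x ∷ xs) = trans (distribˡ y _ _) (+-congˡ (∑ᴸ-* y f xs))

    ∑ᴸ-0 : ∀ (xs : List A) → ∑ᴸ (λ _ → 0#) xs ≈ 0#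
    ∑ᴸ-0 []       = refl
    ∑ᴸ-0 (x ∷ xs) = trans (+-identityˡ _) (∑ᴸ-0 xs)

    ∑ᴸ-guard : ∀ b (f : A → Carrier) xs → ∑ᴸ (λ x → guard b (f x)) xs ≈ guard b (∑ᴸ f xs)
    ∑ᴸ-guard true  f xs = refl
    ∑ᴸ-guard false f xs = ∑ᴸ-0 xs

    ∑ᴸ-++ : ∀ (f : A → Carrier) xs ys → ∑ᴸ f (xs ++ ys) ≈ ∑ᴸ f xs + ∑ᴸ f ys
    ∑ᴸ-++ f []       ys = sym (+-identityˡ _)
    ∑ᴸ-++ f (x ∷ xs) ys = trans (+-congˡ (∑ᴸ-++ f xs ys)) (sym (+-assoc _ _ _))

    ∑ᴸ-filter : ∀ {p} {P : A → Set p} (P? : Decidable P) (f : A → Carrier) xs →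
                ∑ᴸ f (List.filter P? xs) ≈ ∑ᴸ (λ x → guard (does (P? x)) (f x)) xs
    ∑ᴸ-filter P? f []       = refl
    ∑ᴸ-filter P? f (x ∷ xs) with does (P? x)
    ... | true  = +-congˡ (∑ᴸ-filter P? f xs)
    ... | false = trans (∑ᴸ-filter P? f xs) (sym (+-identityˡ _))

    ∑ᴸ-tabulate : ∀ {n} (f : A → Carrier) (g : Fin n → A) → ∑ᴸ f (tabulate g) ≡ sum (f ∘ g)
    ∑ᴸ-tabulate {zero}  f g = ≡.refl
    ∑ᴸ-tabulate {suc n} f g = ≡.cong (f (g Fin.zero) +_) (∑ᴸ-tabulate f (g ∘ Fin.suc))

  ∑ᴸ-cartesianProductWith : ∀ {a b c} {A : Set a} {B : Set b} {C : Set c}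
    (f : C → Carrier) (g : A → B → C) xs ys →
    ∑ᴸ f (cartesianProductWith g xs ys) ≈ ∑ᴸ (λ x → ∑ᴸ (λ y → f (g x y)) ys) xs
  ∑ᴸ-cartesianProductWith f g []       ys = refl
  ∑ᴸ-cartesianProductWith f g (x ∷ xs) ys = begin
    ∑ᴸ f (List.map (g x) ys ++ cartesianProductWith g xs ys)
      ≈⟨ ∑ᴸ-++ f (List.map (g x) ys) _ ⟩
    ∑ᴸ f (List.map (g x) ys) + ∑ᴸ f (cartesianProductWith g xs ys)
      ≈⟨ +-cong (reflexive (≡.cong (List.foldr _+_ 0#) (≡.sym (List.map-∘ ys))))
                (∑ᴸ-cartesianProductWith f g xs ys) ⟩
    ∑ᴸ (f ∘ g x) ys + ∑ᴸ (λ x → ∑ᴸ (λ y → f (g x y)) ys) xs ∎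

  ∑words-suc : ∀ n m (f : Vec (Fin n) (suc m) → Carrier) →
    ∑ᴸ f (words n (suc m)) ≈ ∑[ i < n ] ∑ᴸ (λ v → f (i ∷ v)) (words n m)
  ∑words-suc n m f = trans (∑ᴸ-cartesianProductWith f _∷_ (List.allFin n) (words n m))
                           (reflexive (∑ᴸ-tabulate (λ i → ∑ᴸ (λ v → f (i ∷ v)) (words n m)) id))

  -- Distributivity: expanding the product of sums chooses one letter for each position, and these
  -- choices are the words.
  ∑words-product : ∀ n m (g : Fin m → Fin n → Carrier) →
    ∑ᴸ (λ v → product (λ i → g i (lookup v i))) (words n m) ≈ product (λ i → sum (g i))
  ∑words-product n zero    g = +-identityʳ 1#
  ∑words-product n (suc m) g = begin
    ∑ᴸ (λ v → product (λ i → g i (lookup v i))) (words n (suc m))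
      ≈⟨ ∑words-suc n m _ ⟩
    ∑[ i < n ] ∑ᴸ (λ v → g Fin.zero i * product (λ j → g (Fin.suc j) (lookup v j))) (words n m)
      ≈⟨ sum-cong-≋ (λ i → trans (sym (∑ᴸ-* (g Fin.zero i) _ (words n m)))
                                 (*-congˡ (∑words-product n m (g ∘ Fin.suc)))) ⟩
    ∑[ i < n ] (g Fin.zero i * product (λ j → sum (g (Fin.suc j))))
      ≈⟨ *-distribʳ-sum (product (λ j → sum (g (Fin.suc j)))) (g Fin.zero) ⟨
    product (λ i → sum (g i)) ∎

  -- `punchIn j` enumerates the letters other than `j`. For each position, `sum-remove` splits off
  -- the letter `j`, whose guard is false.
  ∑words-avoiding : ∀ {n} j m (f : Vec (Fin (suc n)) m → Carrier) →
    ∑ᴸ (λ v → guard (does (distinctFrom? j v)) (f v)) (words (suc n) m) ≈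
    ∑ᴸ (λ v → f (Vec.map (punchIn j) v)) (words n m)
  ∑words-avoiding j zero    f = refl
  ∑words-avoiding {n} j (suc m) f = begin
    ∑ᴸ (λ v → guard (does (distinctFrom? j v)) (f v)) (words (suc n) (suc m))
      ≈⟨ ∑words-suc (suc n) m _ ⟩
    sum S
      ≈⟨ sum-remove {i = j} S ⟩
    S j + ∑[ i < n ] S (punchIn j i)
      ≈⟨ +-cong Sj≈0 (sum-cong-≋ S-punchIn) ⟩
    0# + ∑[ i < n ] ∑ᴸ (λ v → f (punchIn j i ∷ Vec.map (punchIn j) v)) (words n m)
      ≈⟨ +-identityˡ _ ⟩
    ∑[ i < n ] ∑ᴸ (λ v → f (punchIn j i ∷ Vec.map (punchIn j) v)) (words n m)
      ≈⟨ ∑words-suc n m _ ⟨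
    ∑ᴸ (λ v → f (Vec.map (punchIn j) v)) (words n (suc m)) ∎
    where
    S : Fin (suc n) → Carrier
    S i = ∑ᴸ (λ v → guard (does (¬? (j Fin.≟ i)) ∧ does (distinctFrom? j v)) (f (i ∷ v)))
             (words (suc n) m)

    Sj≈0 : S j ≈ 0#
    Sj≈0 rewrite dec-true (j Fin.≟ j) ≡.refl = ∑ᴸ-0 (words (suc n) m)

    S-punchIn : ∀ i → S (punchIn j i) ≈ ∑ᴸ (λ v → f (punchIn j i ∷ Vec.map (punchIn j) v)) (words n m)
    S-punchIn i rewrite dec-false (j Fin.≟ punchIn j i) (Fin.punchInᵢ≢i j i ∘ ≡.sym) =
      ∑words-avoiding j m (λ v → f (punchIn j i ∷ v))

  ∑select-tabulate : ∀ {ℓ} {L : Set ℓ} {n} (f : L → List L → Carrier) (γ : Fin (suc n) → L) →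
    ∑select f (tabulate γ) ≈ ∑[ j < suc n ] f (γ j) (tabulate (γ ∘ punchIn j))
  ∑select-tabulate {n = zero}  f γ = refl
  ∑select-tabulate {n = suc n} f γ = +-congˡ (∑select-tabulate (λ c cs → f c (γ Fin.zero ∷ cs)) (γ ∘ Fin.suc))

  -- The first letter `j` selects a column for the first row; the other letters avoid `j` and form,
  -- through `punchIn j`, a permutation of smaller size. The labelings `ρ` and `γ` are arbitrary so
  -- that the induction can pass to `ρ ∘ Fin.suc` and `γ ∘ punchIn j`.
  ∑permutations≈per : ∀ {ℓ} {L : Set ℓ} (w : L → L → Carrier) n (ρ γ : Fin n → L) →
    ∑ᴸ (λ v → guard (does (unique? v)) (product (λ i → w (ρ i) (γ (lookup v i))))) (words n n) ≈
    per w (tabulate ρ) (tabulate γ)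
  ∑permutations≈per w zero    ρ γ = +-identityʳ 1#
  ∑permutations≈per w (suc n) ρ γ = begin
    ∑ᴸ (λ v → guard (does (unique? v)) (product (λ i → w (ρ i) (γ (lookup v i))))) (words (suc n) (suc n))
      ≈⟨ ∑words-suc (suc n) n _ ⟩
    ∑[ j < suc n ] ∑ᴸ (λ v → guard (does (distinctFrom? j v) ∧ does (unique? v)) (F j v)) (words (suc n) n)
      ≈⟨ sum-cong-≋ (λ j → trans
           (∑ᴸ-cong (λ v → reflexive (guard-∧ (does (distinctFrom? j v)) (does (unique? v)) (F j v))) (words (suc n) n))
           (∑words-avoiding j n (λ v → guard (does (unique? v)) (F j v)))) ⟩
    ∑[ j < suc n ] ∑ᴸ (λ v → guard (does (unique? (Vec.map (punchIn j) v))) (F j (Vec.map (punchIn j) v))) (words n n)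
      ≈⟨ sum-cong-≋ (λ j → ∑ᴸ-cong (factor j) (words n n)) ⟩
    ∑[ j < suc n ] ∑ᴸ (λ v → w (ρ Fin.zero) (γ j) * guard (does (unique? v)) (F′ j v)) (words n n)
      ≈⟨ sum-cong-≋ (λ j → sym (∑ᴸ-* (w (ρ Fin.zero) (γ j)) (λ v → guard (does (unique? v)) (F′ j v)) (words n n))) ⟩
    ∑[ j < suc n ] (w (ρ Fin.zero) (γ j) * ∑ᴸ (λ v → guard (does (unique? v)) (F′ j v)) (words n n))
      ≈⟨ sum-cong-≋ (λ j → *-congˡ {w (ρ Fin.zero) (γ j)}
           (∑permutations≈per w n (ρ ∘ Fin.suc) (γ ∘ punchIn j))) ⟩
    ∑[ j < suc n ] (w (ρ Fin.zero) (γ j) * per w (tabulate (ρ ∘ Fin.suc)) (tabulate (γ ∘ punchIn j)))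
      ≈⟨ ∑select-tabulate (λ c cs → w (ρ Fin.zero) c * per w (tabulate (ρ ∘ Fin.suc)) cs) γ ⟨
    per w (tabulate ρ) (tabulate γ) ∎
    where
    F : Fin (suc n) → Vec (Fin (suc n)) n → Carrier
    F j v = w (ρ Fin.zero) (γ j) * product (λ i → w (ρ (Fin.suc i)) (γ (lookup v i)))

    F′ : Fin (suc n) → Vec (Fin n) n → Carrier
    F′ j v = product (λ i → w (ρ (Fin.suc i)) (γ (punchIn j (lookup v i))))

    factor : ∀ j v → guard (does (unique? (Vec.map (punchIn j) v))) (F j (Vec.map (punchIn j) v)) ≈
                     w (ρ Fin.zero) (γ j) * guard (does (unique? v)) (F′ j v)
    factor j v = begin
      guard (does (unique? (Vec.map (punchIn j) v))) (F j (Vec.map (punchIn j) v))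
        ≡⟨ ≡.cong (λ b → guard b (F j (Vec.map (punchIn j) v))) (unique?-punchIn j v) ⟩
      guard (does (unique? v)) (F j (Vec.map (punchIn j) v))
        ≈⟨ guard-cong (does (unique? v)) (*-congˡ (product-cong λ i →
             reflexive (≡.cong (w (ρ (Fin.suc i)) ∘ γ) (Vec.lookup-map i (punchIn j) v)))) ⟩
      guard (does (unique? v)) (w (ρ Fin.zero) (γ j) * F′ j v)
        ≈⟨ guard-* (does (unique? v)) (w (ρ Fin.zero) (γ j)) (F′ j v) ⟩
      w (ρ Fin.zero) (γ j) * guard (does (unique? v)) (F′ j v) ∎

  ^-count : ∀ {a p} {A : Set a} {P : A → Set p} (P? : Decidable P) z {n} (f : Fin n → A) →
    z ^ Vec.count P? (Vec.tabulate f) ≈ product (λ i → if does (P? (f i)) then z else 1#)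
  ^-count P? z {zero}  f = refl
  ^-count P? z {suc n} f with does (P? (f Fin.zero))
  ... | true  = *-congˡ (^-count P? z (f ∘ Fin.suc))
  ... | false = trans (^-count P? z (f ∘ Fin.suc)) (sym (*-identityˡ _))

-- Colored permutations and the specialized parameters

module Specialized {r₁ r₂} (R : CommutativeRing r₁ r₂) (k′ : ℕ)
                   (x y q : CommutativeRing.Carrier R) where

  open CommutativeRing R hiding (zero)
  open import Algebra.Properties.Semiring.Sum semiring
    using (sum; sum-cong-≋; sum-replicate)
  open import Algebra.Properties.CommutativeMonoid.Sum *-commutativeMonoid using ()
    renaming (sum to product; sum-cong-≋ to product-cong; ∑-distrib-+ to product-distrib-*)
  open import Algebra.Properties.Semiring.Exp semiring using (_^_)
  open import Algebra.Properties.Semiring.Mult semiring using () renaming (_×_ to _·_)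
  open import Relation.Binary.Reasoning.Setoid setoid
  open GeneratingFunctions R
  open Permanent R
  open ContinuedFraction R
  open WordSums R

  k : ℕ
  k = suc k′

  X Y Q : Carrier
  X = k · x
  Y = k · y
  Q = k′ · x + q

  -- The Booleans are those to which `isExc?`, `isAexc?` and `isFix?` compute, so `^-count` yields
  -- these factors directly.
  letterWeight : ∀ {n} → Fin n → Fin n → Fin k → Carrier
  letterWeight i a c =
    (if does (i Fin.<? a) ∨ (does (a Fin.≟ i) ∧ does (0 ℕ.<? toℕ c)) then x else 1#) *
    (if does (a Fin.<? i) then y else 1#) *
    (if does (a Fin.≟ i) ∧ does (toℕ c ℕ.≟ 0) then q else 1#)

  weight≈product : ∀ {n} (a : Vec (Fin n) n) (c : Vec (Fin k) n) →
    weight x y q (a , c) ≈ product (λ i → letterWeight i (lookup a i) (lookup c i))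
  weight≈product a c = begin
    weight x y q (a , c)
      ≈⟨ *-cong (*-cong (^-count (isExc? (a , c)) x id) (^-count (isAexc? (a , c)) y id))
                (^-count (isFix? (a , c)) q id) ⟩
    product e * product d * product f
      ≈⟨ trans (product-distrib-* (λ i → e i * d i) f) (*-congʳ (product-distrib-* e d)) ⟨
    product (λ i → letterWeight i (lookup a i) (lookup c i)) ∎
    where
    e d f : Fin _ → Carrier
    e i = if does (isExc? (a , c) i) then x else 1#
    d i = if does (isAexc? (a , c) i) then y else 1#
    f i = if does (isFix? (a , c) i) then q else 1#

  entry : ∀ {n} → Fin n → Fin n → Carrier
  entry i j with Fin.<-cmp i j
  ... | tri< _ _ _ = X
  ... | tri≈ _ _ _ = Q
  ... | tri> _ _ _ = Y

  -- Off the diagonal all `k` colors weigh the same. On it, color 0 gives `q` and each of the other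
  -- `k′` colors gives `x`.
  ∑letterWeight : ∀ {n} (i a : Fin n) → sum (letterWeight i a) ≈ entry i a
  ∑letterWeight i a with Fin.<-cmp i a
  ... | tri< i<a i≢a a≮i
        rewrite dec-true (i Fin.<? a) i<a | dec-false (a Fin.≟ i) (i≢a ∘ ≡.sym)
              | dec-false (a Fin.<? i) a≮i =
        trans (sum-cong-≋ {k} (λ _ → trans (*-identityʳ _) (*-identityʳ x))) (sum-replicate k)
  ... | tri≈ i≮a ≡.refl a≮i
        rewrite dec-false (i Fin.<? i) i≮a | dec-true (i Fin.≟ i) ≡.refl =
        trans (+-cong (trans (*-congʳ (*-identityʳ 1#)) (*-identityˡ q))
                (trans (sum-cong-≋ {k′} (λ _ → trans (*-identityʳ _) (*-identityʳ x)))
                       (sum-replicate k′)))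
              (+-comm _ _)
  ... | tri> i≮a i≢a a<i
        rewrite dec-false (i Fin.<? a) i≮a | dec-false (a Fin.≟ i) (i≢a ∘ ≡.sym)
              | dec-true (a Fin.<? i) a<i =
        trans (sum-cong-≋ {k} (λ _ → trans (*-identityʳ _) (*-identityˡ y))) (sum-replicate k)

  -- nothing labels an open index: as a row or as a column it behaves like a
  -- number smaller than all others, except that it is not matched with nothing.
  labelWeight : ∀ {n} → Maybe (Fin n) → Maybe (Fin n) → Carrier
  labelWeight nothing  nothing  = 0#
  labelWeight nothing  (just _) = X
  labelWeight (just _) nothing  = Y
  labelWeight (just i) (just j) = entry i j

  coloredPermutationSeries≈per : ∀ n → coloredPermutationSeries k x y q n ≈
    per (labelWeight {n}) (tabulate just) (tabulate just)
  coloredPermutationSeries≈per n = begin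
    ∑ᴸ (weight x y q) (𝒮 k n)
      ≈⟨ ∑ᴸ-filter isColoredPermutation? (weight x y q) (List.cartesianProduct (words n n) (words k n)) ⟩
    ∑ᴸ (λ σ → guard (does (isColoredPermutation? σ)) (weight x y q σ)) (List.cartesianProduct (words n n) (words k n))
      -- `isColoredPermutation?` and `unique?` run the same check on the word, so the guards agree
      -- by computation.
      ≈⟨ ∑ᴸ-cartesianProductWith _ _,_ (words n n) (words k n) ⟩
    ∑ᴸ (λ a → ∑ᴸ (λ c → guard (does (unique? a)) (weight x y q (a , c))) (words k n)) (words n n)
      ≈⟨ ∑ᴸ-cong colorSum (words n n) ⟩
    ∑ᴸ (λ a → guard (does (unique? a)) (product (λ i → entry i (lookup a i)))) (words n n)
      ≈⟨ ∑permutations≈per (labelWeight {n}) n just just ⟩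
    per (labelWeight {n}) (tabulate just) (tabulate just) ∎
    where
    colorSum : ∀ a → ∑ᴸ (λ c → guard (does (unique? a)) (weight x y q (a , c))) (words k n) ≈
                     guard (does (unique? a)) (product (λ i → entry i (lookup a i)))
    -- The guard depends on the word alone and leaves the sum over colors, which then factors over
    -- the positions.
    colorSum a = trans (∑ᴸ-guard (does (unique? a)) _ (words k n)) (guard-cong (does (unique? a)) (begin
      ∑ᴸ (λ c → weight x y q (a , c)) (words k n)
        ≈⟨ ∑ᴸ-cong (weight≈product a) (words k n) ⟩
      ∑ᴸ (λ c → product (λ i → letterWeight i (lookup a i) (lookup c i))) (words k n)
        ≈⟨ ∑words-product k n (λ i → letterWeight i (lookup a i)) ⟩
      product (λ i → sum (letterWeight i (lookup a i)))
        ≈⟨ product-cong (λ i → ∑letterWeight i (lookup a i)) ⟩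
      product (λ i → entry i (lookup a i)) ∎))

  entry-< : ∀ {n} {i j : Fin n} → i Fin.< j → entry i j ≈ X
  entry-< {i = i} {j} i<j with Fin.<-cmp i j
  ... | tri< _ _ _   = refl
  ... | tri≈ i≮j _ _ = contradiction i<j i≮j
  ... | tri> i≮j _ _ = contradiction i<j i≮j

  entry-> : ∀ {n} {i j : Fin n} → j Fin.< i → entry i j ≈ Y
  entry-> {i = i} {j} j<i with Fin.<-cmp i j
  ... | tri< _ _ j≮i = contradiction j<i j≮i
  ... | tri≈ _ _ j≮i = contradiction j<i j≮i
  ... | tri> _ _ _   = refl

  entry-≡ : ∀ {n} (i : Fin n) → entry i i ≈ Q
  entry-≡ i with Fin.<-cmp i i
  ... | tri< _ i≢i _ = contradiction ≡.refl i≢i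
  ... | tri≈ _ _ _   = refl
  ... | tri> _ i≢i _ = contradiction ≡.refl i≢i

  α′ β′ : ℕ → Carrier
  α′ = α (specialization k x y q)
  β′ = β (specialization k x y q)

  1^n≈1 : ∀ n → 1# ^ n ≈ 1#
  1^n≈1 zero    = refl
  1^n≈1 (suc n) = trans (*-identityˡ _) (1^n≈1 n)

  [n]⟨1,1⟩ : ∀ n → [ n ]⟨ 1# , 1# ⟩ ≈ n · 1#
  [n]⟨1,1⟩ n = trans
    (sum-cong-≋ {n} (λ i → trans (*-cong (1^n≈1 (n ∸ 1 ∸ toℕ i)) (1^n≈1 (toℕ i))) (*-identityˡ 1#)))
    (sum-replicate n)

  α′≈ : ∀ n → α′ n ≈ Q + n · 1# * X + n · 1# * Y
  α′≈ n = +-cong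
    (+-cong (trans (*-congˡ (1^n≈1 n)) (*-identityʳ Q)) (trans (*-comm _ _) (*-congʳ ([n]⟨1,1⟩ n))))
    (trans (*-comm _ _) (*-congʳ ([n]⟨1,1⟩ n)))

  β′≈ : ∀ n → β′ n ≈ n · 1# * (n · 1# * (X * Y))
  β′≈ n = begin
    X * Y * [ n ]⟨ 1# , 1# ⟩ * [ n ]⟨ 1# , 1# ⟩
      ≈⟨ *-cong (*-congˡ ([n]⟨1,1⟩ n)) ([n]⟨1,1⟩ n) ⟩
    X * Y * (n · 1#) * (n · 1#)
      ≈⟨ trans (*-comm _ _) (*-congˡ (*-comm _ _)) ⟩
    n · 1# * (n · 1# * (X * Y)) ∎

  -- In an increasing list the first label `i` is below all others, so its row has `X` and its
  -- column `Y` against them, just like `nothing`. Hence `openPer-recurrence` applies, and its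
  -- coefficients are `α′ h` and `β′ h`.
  openPer≈motzkin : ∀ {n} h {T : List (Fin n)} → AllPairs Fin._<_ T →
    openPer labelWeight nothing refl h (List.map just T) ≈ motzkin α′ β′ h (List.length T)
  openPer≈motzkin zero    [] = refl
  openPer≈motzkin (suc h) [] =
    -- An open row without proper columns has no match, so the permanent is 0, like the count of
    -- empty paths from positive height.
    per-openRow labelWeight nothing refl (List.replicate h nothing ++ []) (suc h) []
  openPer≈motzkin h {i ∷ T} (i<T ∷ T↑) = begin
    openPer labelWeight nothing refl h (just i ∷ List.map just T)
      ≈⟨ openPer-recurrence labelWeight nothing refl h (just i) (List.map just T)
           (All.map⁺ (All.map entry-> i<T)) (All.map⁺ (All.map entry-< i<T)) ⟩
    _ ≈⟨ +-cong
      (+-cong (openPer≈motzkin (suc h) T↑)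
        (*-cong (trans (+-congʳ (+-congʳ (entry-≡ i))) (sym (α′≈ h))) (openPer≈motzkin h T↑)))
      (*-cong (sym (β′≈ h)) (openPer≈motzkin (pred h) T↑)) ⟩
    motzkin α′ β′ (suc h) (List.length T) + α′ h * motzkin α′ β′ h (List.length T)
      + β′ h * motzkin α′ β′ (pred h) (List.length T)
      ≡⟨ motzkin-suc α′ β′ h (List.length T) ⟨
    motzkin α′ β′ h (suc (List.length T)) ∎

corollary7 : ∀ {r₁ r₂} (R : CommutativeRing r₁ r₂) (k : ℕ) → 1 ≤ k →
    (x y q : CommutativeRing.Carrier R) →
    PowerSeries._≋_ R
    (GeneratingFunctions.𝒞 R (GeneratingFunctions.specialization R k x y q))
    (GeneratingFunctions.coloredPermutationSeries R k x y q)
corollary7 R (suc k′) _ x y q n = begin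
  𝒞 (specialization (suc k′) x y q) n
    -- `β′ 0` vanishes because it contains empty sums.
    ≈⟨ continuedFraction≋motzkin α′ β′ (trans (β′≈ 0) (zeroˡ _)) n ⟩
  motzkin α′ β′ 0 n
    ≡⟨ ≡.cong (motzkin α′ β′ 0) (List.length-tabulate {n = n} id) ⟨
  motzkin α′ β′ 0 (List.length (List.allFin n))
    -- At height 0 there is no border, and `allFin n` is increasing.
    ≈⟨ openPer≈motzkin 0 (AllPairs.tabulate⁺-< {n = n} {f = id} id) ⟨
  per (labelWeight {n}) (List.map just (List.allFin n)) (List.map just (List.allFin n))
    ≡⟨ ≡.cong (λ T → per (labelWeight {n}) T T) (List.map-tabulate {n = n} id just) ⟩
  per (labelWeight {n}) (tabulate just) (tabulate just)
    ≈⟨ coloredPermutationSeries≈per n ⟨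
  coloredPermutationSeries (suc k′) x y q n ∎
  where
  open CommutativeRing R hiding (zero)
  open import Relation.Binary.Reasoning.Setoid setoid
  open GeneratingFunctions R
  open Permanent R
  open ContinuedFraction R
  open Specialized R k′ x y q
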